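{- For a graph $H$, every C6'78-problem on $H$-free graphs is polynomial-time solvable if $H$ is an induced subgraph of $P_1+P_3$ or $P_4$, and NP-complete otherwise.
   Context: A graph $G=(V,E)$ has a vertex set $V$ and an edge set $E$ consisting of unordered pairs of vertices. A statement about a problem "on" (or "for") a graph class refers to the problem with input graphs restricted to that class. A graph is $H$-free if it does not contain $H$ as an induced subgraph, that is, if no graph isomorphic to $H$ can be obtained from it by deleting vertices. $P_r$ and $C_r$ denote the path and the cycle on $r$ vertices, respectively; $G_1+G_2$ denotes the disjoint union of two vertex-disjoint graphs $G_1$ and $G_2$, and $rG$ denotes the disjoint union of $r$ copies of $G$. The line graph of a graph $G$ has as vertices the edges of $G$, with an edge between two distinct vertices $e$ and $f$ if and only if $e$ and $f$ share a common end-vertex in $G$; a graph is a line graph if it is the line graph of some graph. A problem $\Pi$ is a C6'78-problem if it satisfies the following three conditions: C6': $\Pi$ is NP-complete for $H$-free graphs if $H\in\{C_3,C_4,C_5,4P_1,2P_1+P_2,2P_2\}$; C7: $\Pi$ is polynomial-time solvable for $H$-free graphs if $H\in\{P_4,P_1+P_3\}$; C8: $\Pi$ is NP-complete for line graphs.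
   Formalization: The formal theorem additionally assumes that the problem is in NP on all graphs; without this, a problem altered to be undecidable on graphs outside all classes in C6', C7 and C8 would still be a C6'78-problem but not in NP on, say, K_100-free graphs. -}

module Defs where

open import Data.Bool using (Bool; true; false; _∧_; _∨_; not)
open import Data.Bool.Properties using (∨-comm; ∧-zeroʳ)
open import Data.Fin using (Fin; toℕ; splitAt) renaming (_<_ to _<ᶠ_; _≟_ to _≟ᶠ_)
open import Data.List using (List; []; _∷_; _++_; map; foldr; length; replicate; concatMap; allFin)
open import Data.List.Relation.Unary.All using (All)
open import Data.Maybe using (Maybe; just; nothing)
open import Data.Nat using (ℕ; zero; suc; _+_; _*_; _≤_; _≡ᵇ_)
open import Data.Product using (Σ; ∃; ∃-syntax; _×_; _,_)
open import Data.Sum using (_⊎_; inj₁; inj₂)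
open import Data.Unit using (⊤)
open import Function.Bundles using (_⇔_; _↔_; Inverse; mk⇔)
open import Function.Definitions using (Injective)
open import Relation.Binary.PropositionalEquality using (_≡_; _≢_; refl; sym; cong₂; trans; cong)
open import Relation.Nullary using (¬_; does)
open import Relation.Nullary.Decidable using (does-⇔; dec-true)

------------------------------------------------------------------------
-- Finite simple graphs

record Graph : Set where
  field
    order      : ℕ
  Vertex : Set
  Vertex = Fin order
  field
    adj        : Vertex → Vertex → Bool
    adj-sym    : ∀ u v → adj u v ≡ adj v u
    adj-irrefl : ∀ v → adj v v ≡ false

open Graph public using (order; Vertex; adj)

-- Induced subgraphs, up to isomorphism: deleting the vertices of G outside
-- the image of f leaves an isomorphic copy of H.
infix 4 _⊴_
_⊴_ : Graph → Graph → Set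
H ⊴ G = ∃[ f ] Injective _≡_ _≡_ f × (∀ u v → adj G (f u) (f v) ≡ adj H u v)

-- The undirected, loopless graph underlying a binary relation.
fromRel : ∀ n → (Fin n → Fin n → Bool) → Graph
fromRel n r = record
  { order      = n
  ; adj        = λ i j → (r i j ∨ r j i) ∧ not (does (i ≟ᶠ j))
  ; adj-sym    = λ i j → cong₂ _∧_ (∨-comm (r i j) (r j i))
                   (cong not (does-⇔ (mk⇔ sym sym) (i ≟ᶠ j) (j ≟ᶠ i)))
  ; adj-irrefl = λ i → trans (cong (λ b → (r i i ∨ r i i) ∧ not b) (dec-true (i ≟ᶠ i) refl))
                   (∧-zeroʳ (r i i ∨ r i i))
  }

P : ℕ → Graph
P r = fromRel r (λ i j → toℕ j ≡ᵇ suc (toℕ i))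

-- The cycle on r vertices, for r ≥ 3.
C : ℕ → Graph
C r = fromRel r (λ i j → (toℕ j ≡ᵇ suc (toℕ i)) ∨ ((toℕ j ≡ᵇ 0) ∧ (suc (toℕ i) ≡ᵇ r)))

infixr 6 _⊕_
_⊕_ : Graph → Graph → Graph
G₁ ⊕ G₂ = record
  { order      = order G₁ + order G₂
  ; adj        = λ u v → adj⊎ (splitAt (order G₁) u) (splitAt (order G₁) v)
  ; adj-sym    = λ u v → adj⊎-sym (splitAt (order G₁) u) (splitAt (order G₁) v)
  ; adj-irrefl = λ v → adj⊎-irrefl (splitAt (order G₁) v)
  }
  where
  adj⊎ : Vertex G₁ ⊎ Vertex G₂ → Vertex G₁ ⊎ Vertex G₂ → Bool
  adj⊎ (inj₁ u) (inj₁ v) = adj G₁ u v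
  adj⊎ (inj₂ u) (inj₂ v) = adj G₂ u v
  adj⊎ (inj₁ _) (inj₂ _) = false
  adj⊎ (inj₂ _) (inj₁ _) = false

  adj⊎-sym : ∀ x y → adj⊎ x y ≡ adj⊎ y x
  adj⊎-sym (inj₁ u) (inj₁ v) = Graph.adj-sym G₁ u v
  adj⊎-sym (inj₂ u) (inj₂ v) = Graph.adj-sym G₂ u v
  adj⊎-sym (inj₁ _) (inj₂ _) = refl
  adj⊎-sym (inj₂ _) (inj₁ _) = refl

  adj⊎-irrefl : ∀ x → adj⊎ x x ≡ false
  adj⊎-irrefl (inj₁ v) = Graph.adj-irrefl G₁ v
  adj⊎-irrefl (inj₂ v) = Graph.adj-irrefl G₂ v

-- k · G is the disjoint union of k copies of G.
infixr 7 _·_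
_·_ : ℕ → Graph → Graph
zero        · G = P 0
suc zero    · G = G
suc (suc k) · G = G ⊕ (suc k · G)

-- An unordered pair of adjacent vertices, listed in increasing order.
record Edge (G : Graph) : Set where
  field
    end₁ end₂ : Vertex G
    end₁<end₂ : end₁ <ᶠ end₂
    adjacent  : adj G end₁ end₂ ≡ true

_∈ᵉ_ : ∀ {G} → Vertex G → Edge G → Set
v ∈ᵉ e = v ≡ Edge.end₁ e ⊎ v ≡ Edge.end₂ e

LineAdj : ∀ {G} → Edge G → Edge G → Set
LineAdj {G} e f = e ≢ f × ∃[ v ] (_∈ᵉ_ {G} v e × v ∈ᵉ f)

-- L is, up to isomorphism, the line graph of G.
_IsLineGraphOf_ : Graph → Graph → Set
L IsLineGraphOf G = Σ (Vertex L ↔ Edge G) λ φ →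
  ∀ u v → adj L u v ≡ true ⇔ LineAdj (Inverse.to φ u) (Inverse.to φ v)

------------------------------------------------------------------------
-- Graph classes

GraphClass : Set₁
GraphClass = Graph → Set

AllGraphs : GraphClass
AllGraphs _ = ⊤

_-free : Graph → GraphClass
(H -free) G = ¬ (H ⊴ G)

LineGraphs : GraphClass
LineGraphs L = ∃[ G ] (L IsLineGraphOf G)

------------------------------------------------------------------------
-- Deterministic Turing machines with one two-way infinite tape

-- Inputs are written with bits and the separator; the other k symbols are
-- private to the machine.
data Symbol (k : ℕ) : Set where
  blank : Symbol k
  bit   : Bool → Symbol k
  sep   : Symbol k
  work  : Fin k → Symbol k

data Move : Set where
  left right stay : Move

data Action (q k : ℕ) : Set where
  halt : Bool → Action q k
  step : Fin q → Symbol k → Move → Action q k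

record TM : Set where
  field
    states  : ℕ
    symbols : ℕ
    start   : Fin states
    δ       : Fin states → Symbol symbols → Action states symbols

-- All cells beyond the two lists are blank; both lists start with the cell
-- next to the head.
record Tape (k : ℕ) : Set where
  constructor tape
  field
    before  : List (Symbol k)
    current : Symbol k
    after   : List (Symbol k)

load : ∀ {k} → List (Symbol k) → Tape k
load []       = tape [] blank []
load (s ∷ ss) = tape [] s ss

write : ∀ {k} → Symbol k → Tape k → Tape k
write s (tape ls _ rs) = tape ls s rs

move : ∀ {k} → Move → Tape k → Tape k
move stay  t                     = t
move left  (tape []       c rs)  = tape [] blank (c ∷ rs)
move left  (tape (l ∷ ls) c rs)  = tape ls l (c ∷ rs)
move right (tape ls c [])        = tape (c ∷ ls) blank []
move right (tape ls c (r ∷ rs))  = tape (c ∷ ls) r rs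

-- The verdict and final tape of M if it halts within the given number of
-- steps (the halting step included), and nothing otherwise.
run : (M : TM) → ℕ → Fin (TM.states M) → Tape (TM.symbols M) →
      Maybe (Bool × Tape (TM.symbols M))
run M zero    q t = nothing
run M (suc n) q t with TM.δ M q (Tape.current t)
... | halt b       = just (b , t)
... | step q′ s mv = run M n q′ (move mv (write s t))

runOn : (M : TM) → ℕ → List (Symbol (TM.symbols M)) → Maybe (Bool × Tape (TM.symbols M))
runOn M n w = run M n (TM.start M) (load w)

bits : ∀ {k} → List Bool → List (Symbol k)
bits = map bit

pairInput : ∀ {k} → List Bool → List Bool → List (Symbol k)
pairInput x y = bits x ++ sep ∷ bits y

leadingBits : ∀ {k} → List (Symbol k) → List Bool
leadingBits (bit b ∷ ss) = b ∷ leadingBits ss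
leadingBits _            = []

-- The result of a computation: the maximal bit string starting at the head.
output : ∀ {k} → Tape k → List Bool
output (tape _ c rs) = leadingBits (c ∷ rs)

DecidesWithin : (M : TM) → ℕ → List (Symbol (TM.symbols M)) → Bool → Set
DecidesWithin M n w b = ∃[ t ] (runOn M n w ≡ just (b , t))

OutputsWithin : (M : TM) → ℕ → List (Symbol (TM.symbols M)) → List Bool → Set
OutputsWithin M n w y = ∃[ b ] ∃[ t ] (runOn M n w ≡ just (b , t) × output t ≡ y)

------------------------------------------------------------------------
-- Complexity of decision problems

-- Coefficients, constant term first.
Polynomial : Set
Polynomial = List ℕ

⟦_⟧ : Polynomial → ℕ → ℕ
⟦ p ⟧ n = foldr (λ a r → a + n * r) 0 p

-- Algorithms are only required to be correct, and fast, on encodings of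
-- instances.  Distinct elements of Instance may denote the same input: an
-- instance can carry a proof that it lies in the class considered.
record DecisionProblem : Set₁ where
  field
    Instance : Set
    encode   : Instance → List Bool
    Yes      : Instance → Set
  size : Instance → ℕ
  size x = length (encode x)

open DecisionProblem

language : (List Bool → Set) → DecisionProblem
language L = record { Instance = List Bool ; encode = λ w → w ; Yes = L }

PolynomialTimeSolvable : DecisionProblem → Set
PolynomialTimeSolvable A =
  ∃[ M ] ∃[ p ] ∀ (x : Instance A) →
    ∃[ b ] (DecidesWithin M (⟦ p ⟧ (size A x)) (bits (encode A x)) b
            × (b ≡ true ⇔ Yes A x))

-- V is a verifier running in time q, for certificates of length at most p,
-- with p and q polynomials in the size of the instance.
InNP : DecisionProblem → Set
InNP A =
  ∃[ V ] ∃[ p ] ∃[ q ] ∀ (x : Instance A) →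
    let verdict = λ y → DecidesWithin V (⟦ q ⟧ (size A x)) (pairInput (encode A x) y) in
    (∀ y → length y ≤ ⟦ p ⟧ (size A x) → ∃[ b ] verdict y b)
    × (Yes A x ⇔ (∃[ y ] (length y ≤ ⟦ p ⟧ (size A x) × verdict y true)))

-- Polynomial-time many-one reductions.
infix 4 _≤ₚ_
_≤ₚ_ : DecisionProblem → DecisionProblem → Set
A ≤ₚ B =
  ∃[ M ] ∃[ p ] ∀ (x : Instance A) → Σ (Instance B) λ y →
    OutputsWithin M (⟦ p ⟧ (size A x)) (bits (encode A x)) (encode B y)
    × (Yes A x ⇔ Yes B y)

NPHard : DecisionProblem → Set₁
NPHard B = ∀ (L : List Bool → Set) → InNP (language L) → language L ≤ₚ B

NPComplete : DecisionProblem → Set₁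
NPComplete A = InNP A × NPHard A

------------------------------------------------------------------------
-- Graph problems

-- An input is a graph, possibly with further data (such as an integer k or
-- a list of colours for each vertex); problems with a graph as their only
-- input have Extra G = ⊤.
record GraphProblem : Set₁ where
  field
    Extra           : Graph → Set
    encodeExtra     : ∀ G → Extra G → List Bool
    encodeExtra-inj : ∀ G → Injective _≡_ _≡_ (encodeExtra G)
    Yes             : ∀ G → Extra G → Set

-- The number of vertices in unary, then the rows of the adjacency matrix.
encodeGraph : Graph → List Bool
encodeGraph G =
  replicate (order G) true ++ false ∷
  concatMap (λ u → map (adj G u) (allFin (order G))) (allFin (order G))

infix 5 _on_
_on_ : GraphProblem → GraphClass → DecisionProblem
Π on 𝒢 = record
  { Instance = Σ Graph λ G → 𝒢 G × Extra G
  ; encode   = λ (G , _ , e) → encodeGraph G ++ encodeExtra G e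
  ; Yes      = λ (G , _ , e) → Π-Yes G e
  }
  where open GraphProblem Π renaming (Yes to Π-Yes)

record IsC6′78 (Π : GraphProblem) : Set₁ where
  field
    c6′ : All (λ H → NPComplete (Π on (H -free)))
              (C 3 ∷ C 4 ∷ C 5 ∷ 4 · P 1 ∷ 2 · P 1 ⊕ P 2 ∷ 2 · P 2 ∷ [])
    c7  : All (λ H → PolynomialTimeSolvable (Π on (H -free)))
              (P 4 ∷ P 1 ⊕ P 3 ∷ [])
    c8  : NPComplete (Π on LineGraphs)

{-# OPTIONS --safe #-}
module Submission where

-- Algorithms and NP-membership pass to smaller graph classes, NP-hardness to
-- larger ones, and J-free graphs are H-free whenever J ⊴ H.  So it is enough
-- that every H is an induced subgraph of P₁+P₃ or P₄, or contains one of the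
-- six graphs of C6′ or a claw; in the last case C8 applies because line
-- graphs are claw-free.  The dichotomy is a finite check: every graph on five
-- vertices contains one of the seven graphs, which settles all orders ≥ 5,
-- and the graphs on at most four vertices are searched exhaustively.

open import Data.Bool using (Bool; true; false) renaming (_≟_ to _≟ᵇ_)
open import Data.Fin using (Fin; zero; suc; toℕ; inject≤) renaming (_≟_ to _≟ᶠ_)
open import Data.Fin.Properties using (all?; pigeonhole; suc-injective; inject≤-injective; <⇒≢)
open import Data.List using (List; []; _∷_; [_]; allFin; concatMap; head; mapMaybe)
open import Data.List.Relation.Unary.All using ([]; _∷_; lookupAny)
open import Data.List.Relation.Unary.Any using (Any; here; there) renaming (map to Any-map; lookup to Any-lookup)
open import Data.Maybe using (Maybe; just; nothing; from-just; zipWith; _<∣>_) renaming (map to mapᵐ)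
open import Data.Nat using (ℕ; zero; suc; _<_; _≡ᵇ_; _<?_; s≤s)
open import Data.Nat.Properties using (≮⇒≥; n<1+n)
open import Data.Product using (_×_; _,_; proj₁; proj₂)
open import Data.Sum using (_⊎_; inj₁; inj₂)
open import Data.Unit using (tt)
open import Data.Vec using (Vec; []; _∷_; lookup; tabulate)
open import Data.Vec.Properties using (lookup∘tabulate)
open import Function using (_∘_; id)
open import Function.Bundles using (Equivalence; Injection; Inverse)
open import Function.Definitions using (Injective)
open import Function.Properties.Inverse using (Inverse⇒Injection)
open import Relation.Binary.PropositionalEquality using (_≡_; _≢_; refl; sym; trans; cong; subst)
open import Relation.Nullary using (¬_; Dec; yes; no; contradiction)
open import Relation.Nullary.Decidable using (¬?; _×-dec_; dec⇒maybe)
open import Defs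

open Graph using (adj-sym; adj-irrefl)

-- Searching for induced subgraphs

⊴-trans : ∀ {G H K} → G ⊴ H → H ⊴ K → G ⊴ K
⊴-trans (f , f-inj , f-adj) (g , g-inj , g-adj) =
  g ∘ f , f-inj ∘ g-inj , λ u v → trans (g-adj (f u) (f v)) (f-adj u v)

infix 6 _↾_
_↾_ : (G : Graph) → ∀ {n} → (Fin n → Vertex G) → Graph
_↾_ G {n} f = record
  { order      = n
  ; adj        = λ u v → adj G (f u) (f v)
  ; adj-sym    = λ u v → adj-sym G (f u) (f v)
  ; adj-irrefl = λ v → adj-irrefl G (f v)
  }

Extends : ∀ (H G : Graph) {n} (f : Fin (suc n) → Vertex H) → (Fin n → Vertex G) → Vertex G → Set
Extends H G f g x = ∀ u → g u ≢ x × adj G x (g u) ≡ adj H (f zero) (f (suc u))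

extends? : ∀ H G {n} f (g : Fin n → Vertex G) x → Dec (Extends H G f g x)
extends? H G f g x = all? λ u → ¬? (g u ≟ᶠ x) ×-dec (adj G x (g u) ≟ᵇ adj H (f zero) (f (suc u)))

-- `Extends` covers the pairs with `zero` first and `suc` second; symmetry and irreflexivity of both
-- graphs supply the other pairs that involve `zero`.
extend : ∀ {H G n} {f : Fin (suc n) → Vertex H} ((g , _) : H ↾ (f ∘ suc) ⊴ G) {x} →
         Extends H G f g x → H ↾ f ⊴ G
extend {H} {G} {n} {f} (g , g-inj , g-adj) {x} ext = h , h-inj , h-adj
  where
  h : Fin (suc n) → Vertex G
  h zero    = x
  h (suc u) = g u

  h-inj : Injective _≡_ _≡_ h
  h-inj {zero}  {zero}  _ = refl
  h-inj {zero}  {suc v} p = contradiction (sym p) (proj₁ (ext v))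
  h-inj {suc u} {zero}  p = contradiction p (proj₁ (ext u))
  h-inj {suc u} {suc v} p = cong suc (g-inj p)

  h-adj : ∀ u v → adj G (h u) (h v) ≡ adj H (f u) (f v)
  h-adj zero    zero    = trans (adj-irrefl G x) (sym (adj-irrefl H (f zero)))
  h-adj zero    (suc v) = proj₂ (ext v)
  h-adj (suc u) zero    = trans (adj-sym G (g u) x)
    (trans (proj₂ (ext u)) (adj-sym H (f zero) (f (suc u))))
  h-adj (suc u) (suc v) = g-adj u v

-- Backtracking from the last vertex of `f` to the first. Each entry carries its own proof, so any
-- hit is sound.
embeddings : ∀ H G {n} (f : Fin n → Vertex H) → List (H ↾ f ⊴ G)
embeddings H G {zero}  f = [ (λ ()) , (λ { {()} }) , (λ ()) ]
embeddings H G {suc n} f = concatMap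
  (λ e → mapMaybe (λ x → mapᵐ (extend {H} {G} e) (dec⇒maybe (extends? H G f (proj₁ e) x)))
                  (allFin (order G)))
  (embeddings H G (f ∘ suc))

find : ∀ H G → Maybe (H ⊴ G)
-- `H ↾ id` has the order and adjacency of `H` by definition.
find H G = head (embeddings H G id)

findAny : ∀ Hs G → Maybe (Any (_⊴ G) Hs)
findAny []       G = nothing
findAny (H ∷ Hs) G = mapᵐ here (find H G) <∣> mapᵐ there (findAny Hs G)

-- Enumeration of small graphs

-- A graph on suc n vertices as the neighbourhood of vertex zero together
-- with the graph on the other vertices.
data Code : ℕ → Set where
  []  : Code 0
  _∷_ : ∀ {n} → Vec Bool n → Code n → Code (suc n)

decode : ∀ {n} → Code n → Graph
decode {n} c = record { order = n ; adj = a c ; adj-sym = a-sym c ; adj-irrefl = a-irrefl c }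
  where
  a : ∀ {n} → Code n → Fin n → Fin n → Bool
  a (r ∷ c) zero    zero    = false
  a (r ∷ c) zero    (suc v) = lookup r v
  a (r ∷ c) (suc u) zero    = lookup r u
  a (r ∷ c) (suc u) (suc v) = a c u v

  a-sym : ∀ {n} (c : Code n) u v → a c u v ≡ a c v u
  a-sym (r ∷ c) zero    zero    = refl
  a-sym (r ∷ c) zero    (suc v) = refl
  a-sym (r ∷ c) (suc u) zero    = refl
  a-sym (r ∷ c) (suc u) (suc v) = a-sym c u v

  a-irrefl : ∀ {n} (c : Code n) v → a c v v ≡ false
  a-irrefl (r ∷ c) zero    = refl
  a-irrefl (r ∷ c) (suc v) = a-irrefl c v

code : ∀ G {n} → (Fin n → Vertex G) → Code n
code G {zero}  f = []
code G {suc n} f = tabulate (λ v → adj G (f zero) (f (suc v))) ∷ code G (f ∘ suc)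

decode-code : ∀ G {n} (f : Fin n → Vertex G) u v → adj (decode (code G f)) u v ≡ adj G (f u) (f v)
decode-code G f zero    zero    = sym (adj-irrefl G (f zero))
decode-code G f zero    (suc v) = lookup∘tabulate _ v
decode-code G f (suc u) zero    = trans (lookup∘tabulate _ u) (adj-sym G (f zero) (f (suc u)))
decode-code G f (suc u) (suc v) = decode-code G (f ∘ suc) u v

decode-code-⊴ : ∀ G {n} {f : Fin n → Vertex G} → Injective _≡_ _≡_ f → decode (code G f) ⊴ G
decode-code-⊴ G {f = f} f-inj = f , f-inj , λ u v → sym (decode-code G f u v)

⊴-decode-code : ∀ G → G ⊴ decode (code G id)
⊴-decode-code G = id , id , decode-code G id

-- One failing vector makes the whole result `nothing`. A result that evaluates to `just` is a proof
-- for all vectors, which `from-just` extracts during type checking.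
everyVec : ∀ {n} {P : Vec Bool n → Set} → (∀ r → Maybe (P r)) → Maybe (∀ r → P r)
everyVec {zero}  p = mapᵐ (λ q → λ { [] → q }) (p [])
everyVec {suc n} p = zipWith (λ q₀ q₁ → λ { (false ∷ r) → q₀ r ; (true ∷ r) → q₁ r })
  (everyVec (p ∘ (false ∷_))) (everyVec (p ∘ (true ∷_)))

everyCode : ∀ {n} {P : Code n → Set} → (∀ c → Maybe (P c)) → Maybe (∀ c → P c)
everyCode {zero}  p = mapᵐ (λ q → λ { [] → q }) (p [])
everyCode {suc n} p = mapᵐ (λ q → λ { (r ∷ c) → q c r }) (everyCode (λ c → everyVec (λ r → p (r ∷ c))))

everyBelow : ∀ n {Q : ℕ → Set} → (∀ k → Maybe (Q k)) → Maybe (∀ {k} → k < n → Q k)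
everyBelow zero    q = just λ ()
everyBelow (suc n) q = zipWith (λ q₀ qₛ → λ { {zero} _ → q₀ ; {suc k} (s≤s k<n) → qₛ k<n })
  (q 0) (everyBelow n (q ∘ suc))

-- The dichotomy

-- The star with centre 0 and three leaves; `fromRel` removes the loop that the relation has at 0.
claw : Graph
claw = fromRel 4 (λ i j → toℕ i ≡ᵇ 0)

-- After `claw` the order is that of `c6′`, so a position in the tail also selects a proof there.
hardGraphs : List Graph
hardGraphs = claw ∷ C 3 ∷ C 4 ∷ C 5 ∷ 4 · P 1 ∷ 2 · P 1 ⊕ P 2 ∷ 2 · P 2 ∷ []

Easy : Graph → Set
Easy H = H ⊴ P 1 ⊕ P 3 ⊎ H ⊴ P 4

Hard : Graph → Set
Hard H = Any (_⊴ H) hardGraphs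

classify : ∀ G → Maybe (Easy G ⊎ Hard G)
classify G = mapᵐ (inj₁ ∘ inj₁) (find G (P 1 ⊕ P 3)) <∣>
  (mapᵐ (inj₁ ∘ inj₂) (find G (P 4)) <∣> mapᵐ inj₂ (findAny hardGraphs G))

-- Abstract, so that the exhaustive search is not rerun whenever these are mentioned.
abstract
  order-5-hard : (c : Code 5) → Hard (decode c)
  order-5-hard = from-just (everyCode {5} (λ c → findAny hardGraphs (decode c)))

  order-<5-easy-or-hard : ∀ {n} → n < 5 → (c : Code n) → Easy (decode c) ⊎ Hard (decode c)
  order-<5-easy-or-hard = from-just (everyBelow 5 λ k → everyCode {k} (λ c → classify (decode c)))

Easy-hereditary : ∀ {G H} → G ⊴ H → Easy H → Easy G
Easy-hereditary {G} {H} G⊴H (inj₁ e) = inj₁ (⊴-trans {G} {H} {P 1 ⊕ P 3} G⊴H e)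
Easy-hereditary {G} {H} G⊴H (inj₂ e) = inj₂ (⊴-trans {G} {H} {P 4} G⊴H e)

Hard-hereditary : ∀ {G H} → G ⊴ H → Hard G → Hard H
Hard-hereditary {G} {H} G⊴H = Any-map λ {J} J⊴G → ⊴-trans {J} {G} {H} J⊴G G⊴H

easy-or-hard : ∀ H → Easy H ⊎ Hard H
easy-or-hard H with order H <? 5
-- The first five vertices already induce a hard graph.
... | no ≮5 = inj₂ (Hard-hereditary {decode (code H f)} {H}
    (decode-code-⊴ H (inject≤-injective 5≤n 5≤n _ _)) (order-5-hard (code H f)))
  where
  5≤n = ≮⇒≥ ≮5
  f : Fin 5 → Vertex H
  f u = inject≤ u 5≤n
-- `Easy` passes down and `Hard` passes up, so both embeddings between `H` and its decoded copy are
-- used.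
... | yes <5 with order-<5-easy-or-hard <5 (code H id)
...   | inj₁ e = inj₁ (Easy-hereditary {H} {decode (code H id)} (⊴-decode-code H) e)
...   | inj₂ h = inj₂ (Hard-hereditary {decode (code H id)} {H} (decode-code-⊴ H id) h)

-- Line graphs are claw-free

side : ∀ {G} {e : Edge G} {v} → v ∈ᵉ e → Fin 2
side (inj₁ _) = zero
side (inj₂ _) = suc zero

side-injective : ∀ {G} {e : Edge G} {v w} (p : v ∈ᵉ e) (q : w ∈ᵉ e) →
                 side {G} {e} p ≡ side {G} {e} q → v ≡ w
side-injective (inj₁ p) (inj₁ q) _ = trans p (sym q)
side-injective (inj₂ p) (inj₂ q) _ = trans p (sym q)

-- Each leaf edge meets the centre edge in one of its two ends, so two of
-- the three leaf edges share a vertex.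
lineGraph-clawFree : ∀ {L} → LineGraphs L → (claw -free) L
lineGraph-clawFree {L} (G , φ , φ-adj) (f , f-inj , f-adj) =
  let i , j , i<j , same-side = pigeonhole (n<1+n 2) (λ i → side {G} {centre} (shared∈centre i))
      shared≡ = side-injective {G} {centre} (shared∈centre i) (shared∈centre j) same-side
      leaves-adjacent = Equivalence.from (φ-adj (f (suc i)) (f (suc j)))
        ( (λ eq → <⇒≢ i<j (suc-injective (f-inj (to-injective eq))))
        , shared i , shared∈leaf i , subst (_∈ᵉ leaf j) (sym shared≡) (shared∈leaf j))
  -- Adjacency of two leaves of `claw` reduces to `false` for all `i` and `j`.
  in contradiction (trans (sym leaves-adjacent) (f-adj (suc i) (suc j))) λ ()
  where
  open Inverse φ using (to)
  open Injection (Inverse⇒Injection φ) using () renaming (injective to to-injective)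

  centre : Edge G
  centre = to (f zero)

  leaf : Fin 3 → Edge G
  leaf i = to (f (suc i))

  meets : ∀ i → LineAdj centre (leaf i)
  meets i = Equivalence.to (φ-adj (f zero) (f (suc i))) (f-adj zero (suc i))

  shared : Fin 3 → Vertex G
  shared i = proj₁ (proj₂ (meets i))

  shared∈centre : ∀ i → shared i ∈ᵉ centre
  shared∈centre i = proj₁ (proj₂ (proj₂ (meets i)))

  shared∈leaf : ∀ i → shared i ∈ᵉ leaf i
  shared∈leaf i = proj₂ (proj₂ (proj₂ (meets i)))

-- Complexity and graph classes

infix 4 _⊆_
_⊆_ : GraphClass → GraphClass → Set
𝒢 ⊆ 𝒢′ = ∀ {G} → 𝒢 G → 𝒢′ G

free-mono : ∀ {H J} → J ⊴ H → (J -free) ⊆ (H -free)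
free-mono {H} {J} J⊴H {G} J⋬G H⊴G = J⋬G (⊴-trans {J} {H} {G} J⊴H H⊴G)

module _ (Π : GraphProblem) {𝒢 𝒢′ : GraphClass} (𝒢⊆𝒢′ : 𝒢 ⊆ 𝒢′) where

  -- Encodings ignore the proof of class membership, so the same verifier and bounds serve the
  -- smaller class.
  InNP-antitone : InNP (Π on 𝒢′) → InNP (Π on 𝒢)
  InNP-antitone (V , p , q , verifies) =
    V , p , q , λ (G , G∈𝒢 , e) → verifies (G , 𝒢⊆𝒢′ G∈𝒢 , e)

  PolynomialTimeSolvable-antitone : PolynomialTimeSolvable (Π on 𝒢′) → PolynomialTimeSolvable (Π on 𝒢)
  PolynomialTimeSolvable-antitone (M , p , decides) =
    M , p , λ (G , G∈𝒢 , e) → decides (G , 𝒢⊆𝒢′ G∈𝒢 , e)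

  -- The class now restricts the outputs of reductions, hence the opposite direction.
  NPHard-mono : NPHard (Π on 𝒢) → NPHard (Π on 𝒢′)
  NPHard-mono hard L L∈NP =
    let M , p , reduces = hard L L∈NP
    in M , p , λ w → let (G , G∈𝒢 , e) , correct = reduces w in (G , 𝒢⊆𝒢′ G∈𝒢 , e) , correct

Hard⇒NPHard : ∀ {H Π} → IsC6′78 Π → Hard H → NPHard (Π on (H -free))
Hard⇒NPHard {H} {Π} c (here claw⊴H) =
  NPHard-mono Π (λ {L} → free-mono {H} {claw} claw⊴H {L} ∘ lineGraph-clawFree {L})
    (proj₂ (IsC6′78.c8 c))
Hard⇒NPHard {H} {Π} c (there J∈) =
  let (_ , J-hard) , J⊴H = lookupAny (IsC6′78.c6′ c) J∈
  in NPHard-mono Π (λ {G} → free-mono {H} {Any-lookup J∈} J⊴H {G}) J-hard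

theorem3 : (H : Graph) (Π : GraphProblem) →
    InNP (Π on AllGraphs) →
    IsC6′78 Π →
    ((H ⊴ P 1 ⊕ P 3 ⊎ H ⊴ P 4) → PolynomialTimeSolvable (Π on (H -free)))
    × (¬ (H ⊴ P 1 ⊕ P 3 ⊎ H ⊴ P 4) → NPComplete (Π on (H -free)))
theorem3 H Π Π∈NP c with IsC6′78.c7 c
... | P₄-free ∷ P₁+P₃-free ∷ [] = polynomial , complete
  where
  polynomial : Easy H → PolynomialTimeSolvable (Π on (H -free))
  polynomial (inj₁ H⊴) =
    PolynomialTimeSolvable-antitone Π (λ {G} → free-mono {P 1 ⊕ P 3} {H} H⊴ {G}) P₁+P₃-free
  polynomial (inj₂ H⊴) =
    PolynomialTimeSolvable-antitone Π (λ {G} → free-mono {P 4} {H} H⊴ {G}) P₄-free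

  complete : ¬ Easy H → NPComplete (Π on (H -free))
  -- NP-membership passes only to smaller classes, so it comes from `AllGraphs`; hardness comes from
  -- a class inside `H -free`.
  complete ¬easy = InNP-antitone Π (λ {G} _ → tt) Π∈NP , hard
    where
    hard : NPHard (Π on (H -free))
    hard with easy-or-hard H
    ... | inj₁ easy = contradiction easy ¬easy
    ... | inj₂ h    = Hard⇒NPHard {H} {Π} c h
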